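{- Let $\vec x=F(\vec x)$ be a polynomial system of equations over $\overline{\mathbb N}=\mathbb N\cup\{\omega\}$. The minimal solution of this system can be computed from $F$; that is, there is an algorithm which, given the polynomials $F=(f_1,\dots,f_n)$, outputs the minimal solution of $\vec x=F(\vec x)$.
   Context: $\overline{\mathbb N}=\mathbb N\cup\{\omega\}$ with the order and operations of $\mathbb N$ extended by: $i\le\omega$ and $i+\omega=\omega+i=\omega$ for every $i\in\overline{\mathbb N}$; $0\cdot\omega=\omega\cdot0=0$; $i\cdot\omega=\omega\cdot i=\omega$ for every $i\ne0$. $\overline{\mathbb N}^k$ is ordered componentwise. Polynomials are the functions of several variables over $\overline{\mathbb N}$ in the least set containing the constants (including $\omega$) and the variables and closed under addition and multiplication; they are given as input by polynomial expressions. A polynomial system of equations is a set of equations $x_i=f_i(x_1,\dots,x_n)$, $1\le i\le n$, with each $f_i$ a polynomial, abbreviated $\vec x=F(\vec x)$. A minimal solution is $\vec a$ with $\vec a=F(\vec a)$ and $\vec a\le\vec b$ for every $\vec b$ with $\vec b=F(\vec b)$. -}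

module Defs where

open import Data.Fin.Base using (Fin)
open import Data.Nat.Base as ℕ using (ℕ; zero; suc)
open import Data.Product.Base using (_×_)
open import Data.Vec.Base using (Vec; lookup; map)
open import Data.Vec.Relation.Binary.Pointwise.Inductive using (Pointwise)
open import Relation.Binary.PropositionalEquality.Core using (_≡_)
open import Relation.Nullary.Construct.Add.Supremum using (_⁺; ⊤⁺; [_])
import Relation.Binary.Construct.Add.Supremum.NonStrict as AddSupremum

infixl 6 _+_ _⊕_
infixl 7 _*_ _⊗_
infix  4 _≤ᵛ_

ℕ̄ : Set
ℕ̄ = ℕ ⁺

pattern ω = ⊤⁺

open AddSupremum ℕ._≤_ public using () renaming (_≤⁺_ to infix 4 _≤_)

_+_ : ℕ̄ → ℕ̄ → ℕ̄
[ i ] + [ j ] = [ i ℕ.+ j ]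
[ i ] + ω     = ω
ω     + j     = ω

_*_ : ℕ̄ → ℕ̄ → ℕ̄
[ i ]     * [ j ]     = [ i ℕ.* j ]
[ zero ]  * ω         = [ 0 ]
[ suc i ] * ω         = ω
ω         * [ zero ]  = [ 0 ]
ω         * [ suc j ] = ω
ω         * ω         = ω

_≤ᵛ_ : ∀ {k} → Vec ℕ̄ k → Vec ℕ̄ k → Set
_≤ᵛ_ = Pointwise _≤_

-- Polynomial expressions in n variables. The polynomials, as functions
-- Vec ℕ̄ n → ℕ̄, are exactly the ⟦ p ⟧ for p : Poly n.
data Poly (n : ℕ) : Set where
  con     : ℕ̄ → Poly n
  var     : Fin n → Poly n
  _⊕_ _⊗_ : Poly n → Poly n → Poly n

⟦_⟧ : ∀ {n} → Poly n → Vec ℕ̄ n → ℕ̄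
⟦ con c ⟧ a = c
⟦ var i ⟧ a = lookup a i
⟦ p ⊕ q ⟧ a = ⟦ p ⟧ a + ⟦ q ⟧ a
⟦ p ⊗ q ⟧ a = ⟦ p ⟧ a * ⟦ q ⟧ a

-- The i-th entry f of F stands for the equation xᵢ = f(x₁,…,xₙ).  Systems and
-- their solutions are finite first-order data, so a function
-- System n → Vec ℕ̄ n defined without axioms is an algorithm.
System : ℕ → Set
System n = Vec (Poly n) n

⟦_⟧ˢ : ∀ {n} → System n → Vec ℕ̄ n → Vec ℕ̄ n
⟦ F ⟧ˢ a = map (λ f → ⟦ f ⟧ a) F

IsSolution : ∀ {n} → System n → Vec ℕ̄ n → Set
IsSolution F a = a ≡ ⟦ F ⟧ˢ a

IsMinimalSolution : ∀ {n} → System n → Vec ℕ̄ n → Set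
IsMinimalSolution F a = IsSolution F a × (∀ b → IsSolution F b → a ≤ᵛ b)

{-# OPTIONS --safe #-}

-- Variables are eliminated one at a time.  Write f(x,y) = g(y) + x·h(x,y).  If
-- g = 0 or h(g,y) = 0, then g is the least fixed point of x ↦ f(x,y).
-- Otherwise every finite x ≥ g satisfies f(x,y) ≥ g + x > x, so the least fixed
-- point is ω.  In both cases it equals g + ω·g·h(g,y), again a polynomial in y,
-- which can be substituted for x in the remaining equations.  Minimality is
-- proved against all b with F(b) ≤ b, because a solution of the whole system
-- yields only such a point of the reduced one.

module Submission where

open import Algebra.Bundles using (CommutativeSemiring)
open import Algebra.Structures.Biased
  using (isCommutativeMonoidˡ; isCommutativeSemiringˡ)
open import Data.Fin.Base using (zero; suc)
open import Data.Nat.Base as ℕ using (ℕ; zero; suc; z≤n; s≤s)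
import Data.Nat.Properties as ℕ
open import Data.Product.Base using (Σ-syntax; _×_; _,_)
open import Data.Sum.Base using (_⊎_; inj₁; inj₂)
open import Data.Vec.Base using (Vec; []; _∷_; map)
open import Data.Vec.Properties using (map-∘; map-cong)
open import Data.Vec.Relation.Binary.Pointwise.Inductive as Pointwise
  using ([]; _∷_)
open import Level using (0ℓ)
open import Relation.Binary.Bundles using (Poset)
open import Relation.Binary.Construct.Add.Supremum.NonStrict ℕ._≤_
  using ([_]; _≤⊤⁺; ≤⁺-isPartialOrder-≡)
import Relation.Binary.Reasoning.PartialOrder as PosetReasoning
open import Relation.Binary.PropositionalEquality
  using (_≡_; refl; sym; trans; cong; cong₂; subst; isEquivalence; module ≡-Reasoning)
open import Relation.Nullary.Construct.Add.Supremum using ([_])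
open import Relation.Nullary.Negation using (contradiction)
open import Defs

-- The extended naturals as a commutative semiring.

+-identityˡ : ∀ x → [ 0 ] + x ≡ x
+-identityˡ [ i ] = refl
+-identityˡ ω     = refl

+-comm : ∀ x y → x + y ≡ y + x
+-comm [ i ] [ j ] = cong [_] (ℕ.+-comm i j)
+-comm [ i ] ω     = refl
+-comm ω     [ j ] = refl
+-comm ω     ω     = refl

+-assoc : ∀ x y z → (x + y) + z ≡ x + (y + z)
+-assoc [ i ] [ j ] [ k ] = cong [_] (ℕ.+-assoc i j k)
+-assoc [ i ] [ j ] ω     = refl
+-assoc [ i ] ω     z     = refl
+-assoc ω     y     z     = refl

*-comm : ∀ x y → x * y ≡ y * x
*-comm [ i ]     [ j ]     = cong [_] (ℕ.*-comm i j)
*-comm [ zero ]  ω         = refl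
*-comm [ suc i ] ω         = refl
*-comm ω         [ zero ]  = refl
*-comm ω         [ suc j ] = refl
*-comm ω         ω         = refl

*-zeroˡ : ∀ x → [ 0 ] * x ≡ [ 0 ]
*-zeroˡ [ i ] = refl
*-zeroˡ ω     = refl

*-zeroʳ : ∀ x → x * [ 0 ] ≡ [ 0 ]
*-zeroʳ x = trans (*-comm x [ 0 ]) (*-zeroˡ x)

*-identityˡ : ∀ x → [ 1 ] * x ≡ x
*-identityˡ [ i ] = cong [_] (ℕ.*-identityˡ i)
*-identityˡ ω     = refl

*-assoc : ∀ x y z → (x * y) * z ≡ x * (y * z)
*-assoc [ i ] [ j ] [ k ] = cong [_] (ℕ.*-assoc i j k)
-- The zero factors go first, because `[ 0 ]` absorbs even `ω`. Afterwards every factor is positive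
-- and at least one is `ω`, so both sides reduce to `ω`.
*-assoc [ zero ] y z rewrite *-zeroˡ y | *-zeroˡ z | *-zeroˡ (y * z) = refl
*-assoc x [ zero ] z rewrite *-zeroʳ x | *-zeroˡ z | *-zeroʳ x = refl
*-assoc x y [ zero ] rewrite *-zeroʳ (x * y) | *-zeroʳ y | *-zeroʳ x = refl
*-assoc [ suc i ] [ suc j ] ω         = refl
*-assoc [ suc i ] ω         [ suc k ] = refl
*-assoc [ suc i ] ω         ω         = refl
*-assoc ω         [ suc j ] [ suc k ] = refl
*-assoc ω         [ suc j ] ω         = refl
*-assoc ω         ω         [ suc k ] = refl
*-assoc ω         ω         ω         = refl

*-distribʳ-+ : ∀ x y z → (y + z) * x ≡ y * x + z * x
*-distribʳ-+ [ k ] [ i ] [ j ] = cong [_] (ℕ.*-distribʳ-+ k i j)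
*-distribʳ-+ [ zero ] y z
  rewrite *-zeroʳ (y + z) | *-zeroʳ y | *-zeroʳ z = refl
*-distribʳ-+ [ suc k ] [ i ]     ω     = refl
*-distribʳ-+ [ suc k ] ω         z     = refl
*-distribʳ-+ ω         [ zero ]  z
  rewrite +-identityˡ z | +-identityˡ (z * ω) = refl
*-distribʳ-+ ω         [ suc i ] [ j ] = refl
*-distribʳ-+ ω         [ suc i ] ω     = refl
*-distribʳ-+ ω         ω         z     = refl

-- Bundled for the semiring solver, which rearranges terms in the division identity below.
+-*-commutativeSemiring : CommutativeSemiring 0ℓ 0ℓ
+-*-commutativeSemiring = record
  { isCommutativeSemiring = isCommutativeSemiringˡ record
    { +-isCommutativeMonoid = isCommutativeMonoidˡ record
      { isSemigroup = record
        { isMagma = record { isEquivalence = isEquivalence ; ∙-cong = cong₂ _+_ }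
        ; assoc   = +-assoc
        }
      ; identityˡ = +-identityˡ
      ; comm      = +-comm
      }
    ; *-isCommutativeMonoid = isCommutativeMonoidˡ record
      { isSemigroup = record
        { isMagma = record { isEquivalence = isEquivalence ; ∙-cong = cong₂ _*_ }
        ; assoc   = *-assoc
        }
      ; identityˡ = *-identityˡ
      ; comm      = *-comm
      }
    ; distribʳ = *-distribʳ-+
    ; zeroˡ    = *-zeroˡ
    }
  }

open CommutativeSemiring +-*-commutativeSemiring
  using (+-identityʳ; *-identityʳ)
open import Algebra.Solver.Ring.NaturalCoefficients.Default
  +-*-commutativeSemiring using (solve; _:+_; _:*_; _:=_)

-- Order and monotonicity of the operations.

≤-poset : Poset 0ℓ 0ℓ 0ℓ
≤-poset = record
  { isPartialOrder = ≤⁺-isPartialOrder-≡ ℕ.≤-isPartialOrder }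

open Poset ≤-poset using ()
  renaming (refl to ≤-refl; trans to ≤-trans; reflexive to ≤-reflexive)
module ≤-Reasoning = PosetReasoning ≤-poset

0≤ : ∀ x → [ 0 ] ≤ x
0≤ [ i ] = [ z≤n ]
0≤ ω     = [ 0 ] ≤⊤⁺

+-mono-≤ : ∀ {x x′ y y′} → x ≤ x′ → y ≤ y′ → x + y ≤ x′ + y′
+-mono-≤              [ p ]   [ q ]   = [ ℕ.+-mono-≤ p q ]
+-mono-≤ {x′ = [ _ ]} x≤x′    (_ ≤⊤⁺) = _ ≤⊤⁺
+-mono-≤              (_ ≤⊤⁺) y≤y′    = _ ≤⊤⁺

*-monoˡ-≤ : ∀ y {x x′} → x ≤ x′ → x * y ≤ x′ * y
*-monoˡ-≤ [ j ]     [ p ]             = [ ℕ.*-monoˡ-≤ j p ]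
-- Multiplication by `ω` jumps from 0 to `ω` between 0 and 1, so the smaller factor is split at
-- zero.
*-monoˡ-≤ ω         ([_] {zero} _)    = 0≤ _
*-monoˡ-≤ ω         [ s≤s _ ]         = ω ≤⊤⁺
*-monoˡ-≤ [ zero ]  (x ≤⊤⁺)           = ≤-reflexive (*-zeroʳ x)
*-monoˡ-≤ [ suc j ] (x ≤⊤⁺)           = _ ≤⊤⁺
*-monoˡ-≤ ω         (x ≤⊤⁺)           = _ ≤⊤⁺

*-mono-≤ : ∀ {x x′ y y′} → x ≤ x′ → y ≤ y′ → x * y ≤ x′ * y′
*-mono-≤ {x} {x′} {y} {y′} x≤x′ y≤y′ = begin
  x * y    ≤⟨ *-monoˡ-≤ y x≤x′ ⟩
  x′ * y   ≡⟨ *-comm x′ y ⟩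
  y * x′   ≤⟨ *-monoˡ-≤ x′ y≤y′ ⟩
  y′ * x′  ≡⟨ *-comm y′ x′ ⟩
  x′ * y′  ∎
  where open ≤-Reasoning

x≤x+y : ∀ x y → x ≤ x + y
x≤x+y x y = begin
  x          ≡⟨ +-identityʳ x ⟨
  x + [ 0 ]  ≤⟨ +-mono-≤ ≤-refl (0≤ y) ⟩
  x + y      ∎
  where open ≤-Reasoning

ω*-positive : ∀ {x} → [ 1 ] ≤ x → ω * x ≡ ω
ω*-positive [ s≤s _ ] = refl
ω*-positive (_ ≤⊤⁺)   = refl

-- The case split behind the least fixed point. Positivity is phrased as `[ 1 ] ≤ x` so that it
-- passes by transitivity from `h g` to values of `h` at larger arguments.
*-zero-or-positive : ∀ x y → x * y ≡ [ 0 ] ⊎ ([ 1 ] ≤ x × [ 1 ] ≤ y)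
*-zero-or-positive [ zero ]  y         = inj₁ (*-zeroˡ y)
*-zero-or-positive x         [ zero ]  = inj₁ (*-zeroʳ x)
*-zero-or-positive [ suc i ] [ suc j ] = inj₂ ([ s≤s z≤n ] , [ s≤s z≤n ])
*-zero-or-positive [ suc i ] ω         = inj₂ ([ s≤s z≤n ] , (_ ≤⊤⁺))
*-zero-or-positive ω         [ suc j ] = inj₂ ((_ ≤⊤⁺) , [ s≤s z≤n ])
*-zero-or-positive ω         ω         = inj₂ ((_ ≤⊤⁺) , (_ ≤⊤⁺))

-- Least fixed point of `g + x * h x` for monotone `h`.

module LeastFixedPoint
  (g : ℕ̄) (h : ℕ̄ → ℕ̄) (h-mono : ∀ {x y} → x ≤ y → h x ≤ h y)
  where

  -- The factor `ω` acts as a switch: the second summand is 0 if `g * h g` is 0 and `ω` otherwise. A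
  -- case distinction thus becomes a semiring expression.
  lfp : ℕ̄
  lfp = g + ω * (g * h g)

  lfp-zero : g * h g ≡ [ 0 ] → lfp ≡ g
  lfp-zero gh≡0 rewrite gh≡0 = +-identityʳ g

  lfp-positive : [ 1 ] ≤ g → [ 1 ] ≤ h g → lfp ≡ ω
  lfp-positive 1≤g 1≤hg
    rewrite ω*-positive (*-mono-≤ 1≤g 1≤hg) = +-comm g ω

  lfp-fixed : lfp ≡ g + lfp * h lfp
  lfp-fixed with *-zero-or-positive g (h g)
  ... | inj₁ gh≡0 rewrite lfp-zero gh≡0 | gh≡0 = sym (+-identityʳ g)
  ... | inj₂ (1≤g , 1≤hg)
    -- Here `lfp` is `ω`. Since `g ≤ ω`, monotonicity gives `1 ≤ h g ≤ h ω`, hence `ω * h ω` is `ω`.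
    rewrite lfp-positive 1≤g 1≤hg
          | ω*-positive (≤-trans 1≤hg (h-mono (g ≤⊤⁺))) = +-comm ω g

  lfp-least : ∀ x → g + x * h x ≤ x → lfp ≤ x
  lfp-least x fx≤x with *-zero-or-positive g (h g)
  ... | inj₁ gh≡0 = ≤-trans (≤-reflexive (lfp-zero gh≡0)) (≤-trans (x≤x+y g _) fx≤x)
  lfp-least ω     fx≤x | inj₂ _ = _ ≤⊤⁺
  lfp-least [ k ] fx≤x | inj₂ (1≤g , 1≤hg) = contradiction 1+k≤k λ { [ p ] → ℕ.1+n≰n p }
    where
    open ≤-Reasoning
    g≤k : g ≤ [ k ]
    g≤k = ≤-trans (x≤x+y g _) fx≤x
    1+k≤k : [ 1 ] + [ k ] ≤ [ k ]
    1+k≤k = begin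
      -- The factor `[ 1 ]` is inserted to be bounded by `h [ k ]`: from `g ≤ k` follows
      -- `1 ≤ h g ≤ h [ k ]`.
      [ 1 ] + [ k ]          ≡⟨ cong ([ 1 ] +_) (*-identityʳ [ k ]) ⟨
      [ 1 ] + [ k ] * [ 1 ]  ≤⟨ +-mono-≤ 1≤g (*-mono-≤ ≤-refl (≤-trans 1≤hg (h-mono g≤k))) ⟩
      g + [ k ] * h [ k ]    ≤⟨ fx≤x ⟩
      [ k ]                  ∎

-- Monotonicity, substitution and weakening of polynomials.

⟦⟧-mono : ∀ {n} (p : Poly n) {a b} → a ≤ᵛ b → ⟦ p ⟧ a ≤ ⟦ p ⟧ b
⟦⟧-mono (con c) a≤b = ≤-refl
⟦⟧-mono (var i) a≤b = Pointwise.lookup a≤b i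
⟦⟧-mono (p ⊕ q) a≤b = +-mono-≤ (⟦⟧-mono p a≤b) (⟦⟧-mono q a≤b)
⟦⟧-mono (p ⊗ q) a≤b = *-mono-≤ (⟦⟧-mono p a≤b) (⟦⟧-mono q a≤b)

⟦⟧ˢ-mono : ∀ {m n} (ps : Vec (Poly n) m) {a b} → a ≤ᵛ b →
           map (λ p → ⟦ p ⟧ a) ps ≤ᵛ map (λ p → ⟦ p ⟧ b) ps
⟦⟧ˢ-mono []       a≤b = []
⟦⟧ˢ-mono (p ∷ ps) a≤b = ⟦⟧-mono p a≤b ∷ ⟦⟧ˢ-mono ps a≤b

infix 8 _[x₀≔_]

_[x₀≔_] : ∀ {n} → Poly (suc n) → Poly n → Poly n
con c       [x₀≔ e ] = con c
var zero    [x₀≔ e ] = e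
var (suc i) [x₀≔ e ] = var i
(p ⊕ q)     [x₀≔ e ] = p [x₀≔ e ] ⊕ q [x₀≔ e ]
(p ⊗ q)     [x₀≔ e ] = p [x₀≔ e ] ⊗ q [x₀≔ e ]

⟦⟧-[x₀≔] : ∀ {n} (p : Poly (suc n)) e a → ⟦ p [x₀≔ e ] ⟧ a ≡ ⟦ p ⟧ (⟦ e ⟧ a ∷ a)
⟦⟧-[x₀≔] (con c)       e a = refl
⟦⟧-[x₀≔] (var zero)    e a = refl
⟦⟧-[x₀≔] (var (suc i)) e a = refl
⟦⟧-[x₀≔] (p ⊕ q)       e a = cong₂ _+_ (⟦⟧-[x₀≔] p e a) (⟦⟧-[x₀≔] q e a)
⟦⟧-[x₀≔] (p ⊗ q)       e a = cong₂ _*_ (⟦⟧-[x₀≔] p e a) (⟦⟧-[x₀≔] q e a)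

weaken : ∀ {n} → Poly n → Poly (suc n)
weaken (con c) = con c
weaken (var i) = var (suc i)
weaken (p ⊕ q) = weaken p ⊕ weaken q
weaken (p ⊗ q) = weaken p ⊗ weaken q

⟦⟧-weaken : ∀ {n} (p : Poly n) x a → ⟦ weaken p ⟧ (x ∷ a) ≡ ⟦ p ⟧ a
⟦⟧-weaken (con c) x a = refl
⟦⟧-weaken (var i) x a = refl
⟦⟧-weaken (p ⊕ q) x a = cong₂ _+_ (⟦⟧-weaken p x a) (⟦⟧-weaken q x a)
⟦⟧-weaken (p ⊗ q) x a = cong₂ _*_ (⟦⟧-weaken p x a) (⟦⟧-weaken q x a)

-- Division by the first variable.

constantPart : ∀ {n} → Poly (suc n) → Poly n
constantPart p = p [x₀≔ con [ 0 ] ]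

-- p = p₀ + x₀·p₁ and q = q₀ + x₀·q₁ give p·q = p₀·q₀ + x₀·(p₀·q₁ + p₁·q).
quotient : ∀ {n} → Poly (suc n) → Poly (suc n)
quotient (con c)       = con [ 0 ]
quotient (var zero)    = con [ 1 ]
quotient (var (suc i)) = con [ 0 ]
quotient (p ⊕ q)       = quotient p ⊕ quotient q
quotient (p ⊗ q)       = weaken (constantPart p) ⊗ quotient q ⊕ quotient p ⊗ q

⟦⟧-division : ∀ {n} (p : Poly (suc n)) x a →
              ⟦ p ⟧ (x ∷ a) ≡ ⟦ constantPart p ⟧ a + x * ⟦ quotient p ⟧ (x ∷ a)
⟦⟧-division (con c) x a
  rewrite *-zeroʳ x = sym (+-identityʳ c)
⟦⟧-division (var zero) x a
  rewrite *-identityʳ x = sym (+-identityˡ x)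
⟦⟧-division (var (suc i)) x a
  rewrite *-zeroʳ x = sym (+-identityʳ _)
⟦⟧-division (p ⊕ q) x a =
  trans (cong₂ _+_ (⟦⟧-division p x a) (⟦⟧-division q x a))
        (solve 5 (λ p₀ x p₁ q₀ q₁ →
                    (p₀ :+ x :* p₁) :+ (q₀ :+ x :* q₁) :=
                    (p₀ :+ q₀) :+ x :* (p₁ :+ q₁))
               refl (⟦ constantPart p ⟧ a) x _ (⟦ constantPart q ⟧ a) _)
⟦⟧-division (p ⊗ q) x a = begin
  P * Q                              ≡⟨ cong (_* Q) (⟦⟧-division p x a) ⟩
  (P₀ + x * P₁) * Q                  ≡⟨ *-distribʳ-+ Q P₀ (x * P₁) ⟩
  -- Only the first `Q` is expanded; the second stays whole, as in the product clause of `quotient`.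
  P₀ * Q + x * P₁ * Q                ≡⟨ cong (λ r → P₀ * r + x * P₁ * Q) (⟦⟧-division q x a) ⟩
  P₀ * (Q₀ + x * Q₁) + x * P₁ * Q    ≡⟨ solve 6 (λ p₀ q₀ x q₁ p₁ q →
                                          p₀ :* (q₀ :+ x :* q₁) :+ x :* p₁ :* q :=
                                          p₀ :* q₀ :+ x :* (p₀ :* q₁ :+ p₁ :* q))
                                          refl P₀ Q₀ x Q₁ P₁ Q ⟩
  P₀ * Q₀ + x * (P₀ * Q₁ + P₁ * Q)   ≡⟨ cong (λ r → P₀ * Q₀ + x * (r * Q₁ + P₁ * Q))
                                             (⟦⟧-weaken (constantPart p) x a) ⟨
  P₀ * Q₀ + x * (⟦ weaken (constantPart p) ⟧ (x ∷ a) * Q₁ + P₁ * Q) ∎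
  where
  open ≡-Reasoning
  P  = ⟦ p ⟧ (x ∷ a)
  Q  = ⟦ q ⟧ (x ∷ a)
  P₀ = ⟦ constantPart p ⟧ a
  Q₀ = ⟦ constantPart q ⟧ a
  P₁ = ⟦ quotient p ⟧ (x ∷ a)
  Q₁ = ⟦ quotient q ⟧ (x ∷ a)

-- The least fixed point as a polynomial in the other variables.

-- The syntactic form of `lfp`, with `quotient f` in the role of `h`. Being an expression, it can be
-- substituted into other equations.
μx₀ : ∀ {n} → Poly (suc n) → Poly n
μx₀ f = g ⊕ con ω ⊗ (g ⊗ quotient f [x₀≔ g ])
  where g = constantPart f

module _ {n} (f : Poly (suc n)) (a : Vec ℕ̄ n) where

  open LeastFixedPoint
    (⟦ constantPart f ⟧ a) (λ x → ⟦ quotient f ⟧ (x ∷ a))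
    (λ x≤y → ⟦⟧-mono (quotient f) (x≤y ∷ Pointwise.refl ≤-refl))

  ⟦μx₀⟧≡lfp : ⟦ μx₀ f ⟧ a ≡ lfp
  ⟦μx₀⟧≡lfp = cong (λ r → ⟦ constantPart f ⟧ a + ω * (⟦ constantPart f ⟧ a * r))
                   (⟦⟧-[x₀≔] (quotient f) (constantPart f) a)

  ⟦μx₀⟧-fixed : ⟦ μx₀ f ⟧ a ≡ ⟦ f ⟧ (⟦ μx₀ f ⟧ a ∷ a)
  ⟦μx₀⟧-fixed rewrite ⟦μx₀⟧≡lfp = trans lfp-fixed (sym (⟦⟧-division f lfp a))

  ⟦μx₀⟧-least : ∀ x → ⟦ f ⟧ (x ∷ a) ≤ x → ⟦ μx₀ f ⟧ a ≤ x
  ⟦μx₀⟧-least x fx≤x rewrite ⟦μx₀⟧≡lfp =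
    lfp-least x (subst (_≤ x) (⟦⟧-division f x a) fx≤x)

-- Elimination and back substitution.

eliminate : ∀ {n} → System (suc n) → System n
eliminate (f ∷ fs) = map (_[x₀≔ μx₀ f ]) fs

-- Carries solutions of the reduced system up to the full one, and inequalities of the full system
-- down to the reduced one.
⟦eliminate⟧ : ∀ {n} (f : Poly (suc n)) fs a →
              ⟦ eliminate (f ∷ fs) ⟧ˢ a ≡ map (λ p → ⟦ p ⟧ (⟦ μx₀ f ⟧ a ∷ a)) fs
⟦eliminate⟧ f fs a =
  trans (sym (map-∘ _ _ fs)) (map-cong (λ p → ⟦⟧-[x₀≔] p (μx₀ f) a) fs)

-- The recursion descends on the number of variables, since `eliminate F` is not a subterm of `F`.
-- The first coordinate is recovered once the others are known.
minimalSolution : ∀ n → System n → Vec ℕ̄ n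
minimalSolution zero    []         = []
minimalSolution (suc n) F@(f ∷ _) = ⟦ μx₀ f ⟧ a ∷ a
  where a = minimalSolution n (eliminate F)

minimalSolution-solves : ∀ n (F : System n) → IsSolution F (minimalSolution n F)
minimalSolution-solves zero    []       = refl
minimalSolution-solves (suc n) (f ∷ fs) =
  cong₂ _∷_ (⟦μx₀⟧-fixed f a)
    (trans (minimalSolution-solves n (eliminate (f ∷ fs))) (⟦eliminate⟧ f fs a))
  where a = minimalSolution n (eliminate (f ∷ fs))

minimalSolution-least : ∀ n (F : System n) b → ⟦ F ⟧ˢ b ≤ᵛ b → minimalSolution n F ≤ᵛ b
minimalSolution-least zero    []       []      _               = []
minimalSolution-least (suc n) (f ∷ fs) (x ∷ b) (fxb≤x ∷ fsxb≤b) =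
  -- The least fixed point is monotone in its parameters, so its value at `a` is at most that at
  -- `b`, which is at most `x`.
  ≤-trans (⟦⟧-mono (μx₀ f) a≤b) μb≤x ∷ a≤b
  where
  μb≤x : ⟦ μx₀ f ⟧ b ≤ x
  μb≤x = ⟦μx₀⟧-least f b x fxb≤x
  a≤b : minimalSolution n (eliminate (f ∷ fs)) ≤ᵛ b
  a≤b = minimalSolution-least n (eliminate (f ∷ fs)) b
    -- Lowering `x` to `⟦ μx₀ f ⟧ b` can only decrease the values of `fs`, so they remain below `b`
    -- and the induction hypothesis applies.
    (subst (_≤ᵛ b) (sym (⟦eliminate⟧ f fs b))
      (Pointwise.trans ≤-trans
        (⟦⟧ˢ-mono fs (μb≤x ∷ Pointwise.refl ≤-refl)) fsxb≤b))

lemma16 : Σ[ solve ∈ ((n : ℕ) → System n → Vec ℕ̄ n) ]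
    ((n : ℕ) (F : System n) → IsMinimalSolution F (solve n F))
lemma16 = minimalSolution , λ n F →
  minimalSolution-solves n F , λ b b≡Fb →
    minimalSolution-least n F b
      (subst (_≤ᵛ b) b≡Fb (Pointwise.refl ≤-refl))
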